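{- Let $\Gamma \vdash?\, p$ be a $\lambda C$ problem (so $\Gamma$ is a $\lambda C$ context and $p$ is a proposition under $\Gamma$, i.e. $\Gamma \vdash p : \mathsf{U}_0$). If $\Gamma \vdash?\, p$ is essentially higher-order provable (EHOP), then $\Gamma \vdash?\, p$ is provable, i.e. there exists a $\lambda C$ term $t$ such that $\Gamma \vdash t : p$.
   Context: **Pure type systems (PTS).** A PTS is given by a triple $(\mathcal{S},\mathcal{A},\mathcal{R})$ with $\mathcal{S}$ a set of sorts, $\mathcal{A}\subseteq\mathcal{S}^2$, $\mathcal{R}\subseteq\mathcal{S}^3$. Terms: $\mathcal{T} ::= V \mid \mathcal{S} \mid \mathcal{T}\,\mathcal{T} \mid \lambda(V:\mathcal{T}).\mathcal{T} \mid \forall(V:\mathcal{T}).\mathcal{T}$, where $V$ is an infinite set of variables; terms are considered up to renaming of bound variables. $A\to B$ abbreviates $\forall(x:A).B$ with $x$ not free in $B$. $\cong$ denotes $\beta\eta$-equivalence. A context is a finite list of declarations $x_1:\alpha_1,\dots,x_n:\alpha_n$; contexts are well-formed (derivable by the rules). The judgement $\Gamma\vdash t:\alpha$ is generated by: (axioms) $\emptyset\vdash s_1:s_2$ if $(s_1,s_2)\in\mathcal{A}$; (start) from $\Gamma\vdash A:s$ infer $\Gamma,x:A\vdash x:A$ if $x\notin\Gamma$; (weakening) from $\Gamma\vdash A:B$ and $\Gamma\vdash C:s$ infer $\Gamma,x:C\vdash A:B$ if $x\notin\Gamma$; (product) from $\Gamma\vdash A:s_1$ and $\Gamma,x:A\vdash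 B:s_2$ infer $\Gamma\vdash(\forall x:A.B):s_3$ if $(s_1,s_2,s_3)\in\mathcal{R}$; (application) from $\Gamma\vdash f:(\forall x:A.B)$ and $\Gamma\vdash a:A$ infer $\Gamma\vdash f\,a:B[x:=a]$; (abstraction) from $\Gamma,x:A\vdash b:B$ and $\Gamma\vdash(\forall x:A.B):s$ infer $\Gamma\vdash(\lambda x:A.b):(\forall x:A.B)$; (conversion) from $\Gamma\vdash A:B$, $\Gamma\vdash B':s$ and $B\cong B'$ infer $\Gamma\vdash A:B'$. (Here $s$ ranges over sorts.) **$\lambda C$**: sorts $\mathsf{U}_\ell$ ($\ell\in\mathbb{N}$), axioms $(\mathsf{U}_\ell,\mathsf{U}_{\ell+1})$, rules $(\mathsf{U}_\ell,\mathsf{U}_m,\mathsf{U}_{\mathsf{imax}(\ell,m)})$ where $\mathsf{imax}(\ell,m)=\max(\ell,m)$ if $m>0$ and $\mathsf{imax}(\ell,0)=0$. Its set of terms is $\mathcal{T}_C$. In $\lambda C$: $\bot:=\forall p:\mathsf{U}_0.p$, $\neg p:=p\to\bot$, $p\lor q:=\forall r:\mathsf{U}_0.(p\to r)\to(q\to r)\to r$. **$\lambda_\to^*$**: sorts $\mathsf{U}_\ell,\mathsf{U}_\ell'$ ($\ell\in\mathbb{N}^*=\{1,2,\dots\}$), axioms $(\mathsf{U}_\ell,\mathsf{U}_\ell')$, rules $(\mathsf{U}_\ell,\mathsf{U}_m,\mathsf{U}_{\max\{\ell,m\}})$ for $\ell,m\in\mathbb{N}^*$. **$\mathrm{HOL}^*$**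 is $\lambda_\to^*$ with additional term symbols $\mathsf{Bool}$, $\bot'$, $\to'$, and $\forall'_s$ for each term $s$, and additional typing rules $\vdash\mathsf{Bool}:\mathsf{U}_1$; $\Gamma\vdash\bot':\mathsf{Bool}$; $\Gamma\vdash{\to'}:\mathsf{Bool}\to\mathsf{Bool}\to\mathsf{Bool}$; and from $\Gamma\vdash s:\mathsf{U}_\ell$ infer $\Gamma\vdash\forall'_s:(s\to\mathsf{Bool})\to\mathsf{Bool}$. Its set of terms is $\mathcal{T}_\to^*$. **Canonical embedding** $\pi^*:\mathcal{T}_\to^*\to\mathcal{T}_C$: $\pi^*(\mathsf{Bool})=\mathsf{U}_0$, $\pi^*(\mathsf{U}_\ell)=\mathsf{U}_\ell$, $\pi^*(\mathsf{U}'_\ell)=\mathsf{U}_{\ell+1}$, $\pi^*(x)=x$ for $x\in V$, $\pi^*(M\,N)=\pi^*(M)\,\pi^*(N)$, $\pi^*(\lambda(x:s).M)=\lambda(x:\pi^*(s)).\pi^*(M)$, $\pi^*(\forall(x:s).M)=\forall(x:\pi^*(s)).\pi^*(M)$, $\pi^*(\bot')=\forall(\alpha:\mathsf{U}_0).\alpha$, $\pi^*(\to')=\lambda(p\ q:\mathsf{U}_0).p\to q$, $\pi^*(\forall'_s)=\lambda(p:\pi^*(s)\to\mathsf{U}_0).\forall(x:\pi^*(s)).p\,x$. On contexts: $\pi^*(\emptyset)=\emptyset$, $\pi^*(\Gamma,x:\sigma)=\pi^*(\Gamma),x:\pi^*(\sigma)$. **Substitutions.** For $\sigma:V\to\mathcal{T}_C$,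 its extension $\overline\sigma:\mathcal{T}_C\to\mathcal{T}_C$ is the (capture-avoiding) simultaneous substitution: $\overline\sigma(\mathsf{U}_\ell)=\mathsf{U}_\ell$, $\overline\sigma(x)=\sigma(x)$, $\overline\sigma(M\,N)=\overline\sigma(M)\,\overline\sigma(N)$, $\overline\sigma(\lambda x:s.M)=\lambda x:\overline\sigma(s).\overline{\sigma[x\mapsto x]}(M)$, $\overline\sigma(\forall x:s.M)=\forall x:\overline\sigma(s).\overline{\sigma[x\mapsto x]}(M)$. A substitution is a triple $(\Gamma,\Gamma',\sigma)$ with $\Gamma,\Gamma'$ $\lambda C$ contexts and $\sigma:V\to\mathcal{T}_C$ such that $\Gamma'\vdash\sigma(u):\overline\sigma(\tau)$ for every $(u:\tau)\in\Gamma$. **Problems.** A ($\mathrm{HOL}^*$ / $\lambda C$) problem $\Gamma\vdash?\,p$ is a pair of a ($\mathrm{HOL}^*$ / $\lambda C$) context $\Gamma$ and a ($\mathrm{HOL}^*$ / $\lambda C$) proposition $p$ under $\Gamma$ (i.e. $\Gamma\vdash p:\mathsf{Bool}$ in $\mathrm{HOL}^*$, resp. $\Gamma\vdash p:\mathsf{U}_0$ in $\lambda C$). A $\lambda C$ problem $\Gamma\vdash?\,p$ is provable iff there is a $\lambda C$ term $t$ with $\Gamma\vdash t:p$. A $\mathrm{HOL}^*$ problem $\Gamma\vdash?\,p$ is provable iff there is a $\lambda C$ term $t$ with $\pi^*(\Gamma)\vdash t:\pi^*(p)$ in $\lambda C$. Convention: excluded middle $\mathsf{em}:\forall(p:\mathsf{U}_0).\,p\lor\neg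 p$ is implicitly contained in the hypotheses of all problems, i.e. all the $\lambda C$ judgements in these definitions (and in the definition of substitution) are taken with a reserved declaration $\mathsf{em}$ of this type prepended to the context, and substitutions fix $\mathsf{em}$. **EHOP.** A $\lambda C$ problem $\Gamma\vdash?\,p$ is EHOP iff there exist a provable $\mathrm{HOL}^*$ problem $\Gamma'\vdash?\,p'$ and a substitution $(\pi^*(\Gamma'),\Gamma,\sigma)$ such that $p\cong\overline\sigma(\pi^*(p'))$. -}

module Defs where

open import Data.Nat using (ℕ; zero; suc; _⊔_; NonZero)
open import Data.List using (List; []; _∷_; _∷ʳ_; length; map)
open import Data.Product using (Σ; ∃; ∃₂; _×_; _,_)
open import Relation.Binary.PropositionalEquality using (_≡_)
open import Relation.Binary.Construct.Closure.Equivalence using (EqClosure)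

-- Terms up to renaming of bound variables are represented with de Bruijn
-- indices.  The indices are unscoped naturals, so a substitution is a total
-- map from variables to terms.  The head of a context is its most recent
-- declaration; the outermost declaration is the last element of the list.

infixl 5 _▸_
pattern _▸_ Γ A = A ∷ Γ

liftRen : (ℕ → ℕ) → ℕ → ℕ
liftRen ρ zero    = zero
liftRen ρ (suc x) = suc (ρ x)

module PTS (Sort : Set) (Axiom : Sort → Sort → Set)
           (Rule : Sort → Sort → Sort → Set) where

  infixl 7 _·_
  infixr 6 _⇒_
  infix  4 _⟶_ _≅_ _∋_∶_ _⊢_∶_

  data Term : Set where
    var  : ℕ → Term
    sort : Sort → Term
    _·_  : Term → Term → Term
    ƛ    : Term → Term → Term
    Π    : Term → Term → Term

  rename : (ℕ → ℕ) → Term → Term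
  rename ρ (var x)  = var (ρ x)
  rename ρ (sort s) = sort s
  rename ρ (M · N)  = rename ρ M · rename ρ N
  rename ρ (ƛ A M)  = ƛ (rename ρ A) (rename (liftRen ρ) M)
  rename ρ (Π A B)  = Π (rename ρ A) (rename (liftRen ρ) B)

  wk : Term → Term
  wk = rename suc

  _⇒_ : Term → Term → Term
  A ⇒ B = Π A (wk B)

  lift : (ℕ → Term) → ℕ → Term
  lift σ zero    = var zero
  lift σ (suc x) = wk (σ x)

  subst : (ℕ → Term) → Term → Term
  subst σ (var x)  = σ x
  subst σ (sort s) = sort s
  subst σ (M · N)  = subst σ M · subst σ N
  subst σ (ƛ A M)  = ƛ (subst σ A) (subst (lift σ) M)
  subst σ (Π A B)  = Π (subst σ A) (subst (lift σ) B)

  instantiate : Term → ℕ → Term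
  instantiate N zero    = N
  instantiate N (suc x) = var x

  _[_] : Term → Term → Term
  M [ N ] = subst (instantiate N) M

  data _⟶_ : Term → Term → Set where
    β  : ∀ {A M N} → ƛ A M · N ⟶ M [ N ]
    η  : ∀ {A M} → ƛ A (wk M · var 0) ⟶ M
    ·ˡ : ∀ {M M′ N} → M ⟶ M′ → M · N ⟶ M′ · N
    ·ʳ : ∀ {M N N′} → N ⟶ N′ → M · N ⟶ M · N′
    ƛˡ : ∀ {A A′ M} → A ⟶ A′ → ƛ A M ⟶ ƛ A′ M
    ƛʳ : ∀ {A M M′} → M ⟶ M′ → ƛ A M ⟶ ƛ A M′
    Πˡ : ∀ {A A′ B} → A ⟶ A′ → Π A B ⟶ Π A′ B
    Πʳ : ∀ {A B B′} → B ⟶ B′ → Π A B ⟶ Π A B′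

  _≅_ : Term → Term → Set
  _≅_ = EqClosure _⟶_

  Ctx : Set
  Ctx = List Term

  data _∋_∶_ : Ctx → ℕ → Term → Set where
    here  : ∀ {Γ A} → Γ ▸ A ∋ zero ∶ wk A
    there : ∀ {Γ x A B} → Γ ∋ x ∶ A → Γ ▸ B ∋ suc x ∶ wk A

  data _⊢_∶_ : Ctx → Term → Term → Set where
    axiom : ∀ {s₁ s₂} → Axiom s₁ s₂ → [] ⊢ sort s₁ ∶ sort s₂
    start : ∀ {Γ A s} → Γ ⊢ A ∶ sort s → Γ ▸ A ⊢ var 0 ∶ wk A
    weakening : ∀ {Γ A B C s} →
      Γ ⊢ A ∶ B → Γ ⊢ C ∶ sort s → Γ ▸ C ⊢ wk A ∶ wk B
    product : ∀ {Γ A B s₁ s₂ s₃} → Rule s₁ s₂ s₃ →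
      Γ ⊢ A ∶ sort s₁ → Γ ▸ A ⊢ B ∶ sort s₂ → Γ ⊢ Π A B ∶ sort s₃
    application : ∀ {Γ f a A B} →
      Γ ⊢ f ∶ Π A B → Γ ⊢ a ∶ A → Γ ⊢ f · a ∶ B [ a ]
    abstraction : ∀ {Γ A b B s} →
      Γ ▸ A ⊢ b ∶ B → Γ ⊢ Π A B ∶ sort s → Γ ⊢ ƛ A b ∶ Π A B
    conversion : ∀ {Γ A B B′ s} →
      Γ ⊢ A ∶ B → Γ ⊢ B′ ∶ sort s → B ≅ B′ → Γ ⊢ A ∶ B′

  WellFormed : Ctx → Set
  WellFormed Γ = ∃₂ λ t A → Γ ⊢ t ∶ A

module λC where

  data Sort : Set where
    U : ℕ → Sort

  imax : ℕ → ℕ → ℕ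
  imax ℓ zero    = 0
  imax ℓ (suc m) = ℓ ⊔ suc m

  data Axiom : Sort → Sort → Set where
    ax : ∀ ℓ → Axiom (U ℓ) (U (suc ℓ))

  data Rule : Sort → Sort → Sort → Set where
    rule : ∀ ℓ m → Rule (U ℓ) (U m) (U (imax ℓ m))

  open PTS Sort Axiom Rule public

  Prop₀ : Term
  Prop₀ = sort (U 0)

  ⊥ᶜ : Term
  ⊥ᶜ = Π Prop₀ (var 0)

  ¬ᶜ_ : Term → Term
  ¬ᶜ p = p ⇒ ⊥ᶜ

  _∨ᶜ_ : Term → Term → Term
  p ∨ᶜ q = Π Prop₀ ((wk p ⇒ var 0) ⇒ (wk q ⇒ var 0) ⇒ var 0)

  EM : Term
  EM = Π Prop₀ (var 0 ∨ᶜ (¬ᶜ var 0))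

  -- Being outermost, the reserved variable em has index length Γ in em▸ Γ,
  -- and the variables declared in Γ keep their indices.
  em▸_ : Ctx → Ctx
  em▸ Γ = Γ ∷ʳ EM

  record IsSubstitution (Γ Γ′ : Ctx) (σ : ℕ → Term) : Set where
    field
      wf-source : WellFormed (em▸ Γ)
      wf-target : WellFormed (em▸ Γ′)
      fixes-em  : σ (length Γ) ≡ var (length Γ′)
      typed     : ∀ {u τ} → Γ ∋ u ∶ τ → (em▸ Γ′) ⊢ σ u ∶ subst σ τ

  record Problem : Set where
    constructor problem
    field
      context       : Ctx
      goal          : Term
      isProposition : (em▸ context) ⊢ goal ∶ Prop₀

  Provable : Problem → Set
  Provable (problem Γ p _) = ∃ λ t → (em▸ Γ) ⊢ t ∶ p

module λ→* where

  data Sort : Set where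
    U  : (ℓ : ℕ) .{{_ : NonZero ℓ}} → Sort
    U′ : (ℓ : ℕ) .{{_ : NonZero ℓ}} → Sort

  ⊔-nonZero : ∀ ℓ m .{{_ : NonZero ℓ}} → NonZero (ℓ ⊔ m)
  ⊔-nonZero (suc ℓ) zero    = _
  ⊔-nonZero (suc ℓ) (suc m) = _

  data Axiom : Sort → Sort → Set where
    ax : ∀ ℓ .{{_ : NonZero ℓ}} → Axiom (U ℓ) (U′ ℓ)

  data Rule : Sort → Sort → Sort → Set where
    rule : ∀ ℓ m .{{_ : NonZero ℓ}} .{{_ : NonZero m}} →
      Rule (U ℓ) (U m) (U (ℓ ⊔ m) {{⊔-nonZero ℓ m}})

-- The extra symbol ∀′ s contains the term s, so renaming, substitution and
-- βη-equivalence act inside s; this is why HOL* has its own syntax instead of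
-- being an instance of PTS.
module HOL* where

  open λ→* public

  infixl 7 _·_
  infixr 6 _⇒_
  infix  4 _⟶_ _≅_ _⊢_∶_

  data Term : Set where
    var  : ℕ → Term
    sort : Sort → Term
    _·_  : Term → Term → Term
    ƛ    : Term → Term → Term
    Π    : Term → Term → Term
    Bool : Term
    ⊥′   : Term
    →′   : Term
    ∀′   : Term → Term

  rename : (ℕ → ℕ) → Term → Term
  rename ρ (var x)  = var (ρ x)
  rename ρ (sort s) = sort s
  rename ρ (M · N)  = rename ρ M · rename ρ N
  rename ρ (ƛ A M)  = ƛ (rename ρ A) (rename (liftRen ρ) M)
  rename ρ (Π A B)  = Π (rename ρ A) (rename (liftRen ρ) B)
  rename ρ Bool     = Bool
  rename ρ ⊥′       = ⊥′
  rename ρ →′       = →′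
  rename ρ (∀′ s)   = ∀′ (rename ρ s)

  wk : Term → Term
  wk = rename suc

  _⇒_ : Term → Term → Term
  A ⇒ B = Π A (wk B)

  lift : (ℕ → Term) → ℕ → Term
  lift σ zero    = var zero
  lift σ (suc x) = wk (σ x)

  subst : (ℕ → Term) → Term → Term
  subst σ (var x)  = σ x
  subst σ (sort s) = sort s
  subst σ (M · N)  = subst σ M · subst σ N
  subst σ (ƛ A M)  = ƛ (subst σ A) (subst (lift σ) M)
  subst σ (Π A B)  = Π (subst σ A) (subst (lift σ) B)
  subst σ Bool     = Bool
  subst σ ⊥′       = ⊥′
  subst σ →′       = →′
  subst σ (∀′ s)   = ∀′ (subst σ s)

  instantiate : Term → ℕ → Term
  instantiate N zero    = N
  instantiate N (suc x) = var x

  _[_] : Term → Term → Term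
  M [ N ] = subst (instantiate N) M

  data _⟶_ : Term → Term → Set where
    β   : ∀ {A M N} → ƛ A M · N ⟶ M [ N ]
    η   : ∀ {A M} → ƛ A (wk M · var 0) ⟶ M
    ·ˡ  : ∀ {M M′ N} → M ⟶ M′ → M · N ⟶ M′ · N
    ·ʳ  : ∀ {M N N′} → N ⟶ N′ → M · N ⟶ M · N′
    ƛˡ  : ∀ {A A′ M} → A ⟶ A′ → ƛ A M ⟶ ƛ A′ M
    ƛʳ  : ∀ {A M M′} → M ⟶ M′ → ƛ A M ⟶ ƛ A M′
    Πˡ  : ∀ {A A′ B} → A ⟶ A′ → Π A B ⟶ Π A′ B
    Πʳ  : ∀ {A B B′} → B ⟶ B′ → Π A B ⟶ Π A B′
    ∀′ₛ : ∀ {s s′} → s ⟶ s′ → ∀′ s ⟶ ∀′ s′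

  _≅_ : Term → Term → Set
  _≅_ = EqClosure _⟶_

  Ctx : Set
  Ctx = List Term

  -- The rules for ⊥′ and →′ hold in every well-formed context; their premise
  -- Γ ⊢ t ∶ α, with t and α arbitrary, says that Γ is well-formed.
  data _⊢_∶_ : Ctx → Term → Term → Set where
    axiom : ∀ {s₁ s₂} → Axiom s₁ s₂ → [] ⊢ sort s₁ ∶ sort s₂
    start : ∀ {Γ A s} → Γ ⊢ A ∶ sort s → Γ ▸ A ⊢ var 0 ∶ wk A
    weakening : ∀ {Γ A B C s} →
      Γ ⊢ A ∶ B → Γ ⊢ C ∶ sort s → Γ ▸ C ⊢ wk A ∶ wk B
    product : ∀ {Γ A B s₁ s₂ s₃} → Rule s₁ s₂ s₃ →
      Γ ⊢ A ∶ sort s₁ → Γ ▸ A ⊢ B ∶ sort s₂ → Γ ⊢ Π A B ∶ sort s₃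
    application : ∀ {Γ f a A B} →
      Γ ⊢ f ∶ Π A B → Γ ⊢ a ∶ A → Γ ⊢ f · a ∶ B [ a ]
    abstraction : ∀ {Γ A b B s} →
      Γ ▸ A ⊢ b ∶ B → Γ ⊢ Π A B ∶ sort s → Γ ⊢ ƛ A b ∶ Π A B
    conversion : ∀ {Γ A B B′ s} →
      Γ ⊢ A ∶ B → Γ ⊢ B′ ∶ sort s → B ≅ B′ → Γ ⊢ A ∶ B′
    bool : [] ⊢ Bool ∶ sort (U 1)
    false : ∀ {Γ t α} → Γ ⊢ t ∶ α → Γ ⊢ ⊥′ ∶ Bool
    implication : ∀ {Γ t α} → Γ ⊢ t ∶ α → Γ ⊢ →′ ∶ Bool ⇒ Bool ⇒ Bool
    universal : ∀ {Γ s ℓ} .{{_ : NonZero ℓ}} →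
      Γ ⊢ s ∶ sort (U ℓ) → Γ ⊢ ∀′ s ∶ (s ⇒ Bool) ⇒ Bool

  record Problem : Set where
    constructor problem
    field
      context       : Ctx
      goal          : Term
      isProposition : context ⊢ goal ∶ Bool

π* : HOL*.Term → λC.Term
π* (HOL*.var x)           = λC.var x
π* (HOL*.sort (HOL*.U ℓ))  = λC.sort (λC.U ℓ)
π* (HOL*.sort (HOL*.U′ ℓ)) = λC.sort (λC.U (suc ℓ))
π* (M HOL*.· N)           = π* M λC.· π* N
π* (HOL*.ƛ s M)           = λC.ƛ (π* s) (π* M)
π* (HOL*.Π s M)           = λC.Π (π* s) (π* M)
π* HOL*.Bool              = λC.Prop₀
π* HOL*.⊥′                = λC.Π λC.Prop₀ (λC.var 0)
π* HOL*.→′                = ƛ Prop₀ (ƛ Prop₀ (var 1 ⇒ var 0))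
  where open λC
π* (HOL*.∀′ s)            = ƛ (π* s ⇒ Prop₀) (Π (wk (π* s)) (var 1 · var 0))
  where open λC

π*-ctx : HOL*.Ctx → λC.Ctx
π*-ctx = map π*

HOL*-Provable : HOL*.Problem → Set
HOL*-Provable (HOL*.problem Γ p _) =
  ∃ λ t → (λC.em▸ π*-ctx Γ) λC.⊢ t ∶ π* p

EHOP : λC.Problem → Set
EHOP (λC.problem Γ p _) =
  Σ HOL*.Problem λ P′ → let open HOL*.Problem P′ renaming (context to Γ′; goal to p′) in
    HOL*-Provable P′ ×
    (∃ λ σ → λC.IsSubstitution (π*-ctx Γ′) Γ σ × (p λC.≅ λC.subst σ (π* p′)))

{-# OPTIONS --safe #-}
module Submission where

open import Defs
open import Data.Nat using (ℕ; zero; suc)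
open import Data.List using ([]; _∷_; length)
open import Data.Product using (∃; _×_; _,_)
open import Data.Sum using (_⊎_; inj₁; inj₂)
open import Relation.Binary.PropositionalEquality
  using (_≡_; refl; sym; trans; cong; cong₂)
  renaming (subst to transport; subst₂ to transport₂)
open import Relation.Binary.Construct.Closure.Equivalence using (gmap; symmetric)

-- Provability in λC is stable under substitution, so a proof t of the HOL*
-- problem gives the proof σ̄(t) of σ̄(π*(p′)), which proves p by conversion.

-- Provability of a HOL* problem is by definition a statement about its image in λC, so the argument
-- stays inside λC. It rests on the substitution lemma `⊢-subst`, which holds in every pure type
-- system by induction on the derivation, for all substitutions and target contexts at once. The
-- application case uses that substitution commutes with instantiation (`subst-[]`), the conversion
-- case that it preserves `≅` (`≅-subst`), and the binder cases extend source and target together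
-- (`⇛-lift`). `IsSubstitution⇒⇛` brings the reserved `em` under the same lemma.

module PTSProperties (Sort : Set) (Axiom : Sort → Sort → Set)
                     (Rule : Sort → Sort → Sort → Set) where

  open PTS Sort Axiom Rule

  -- The fusion laws take pointwise equations between substitutions as
  -- hypotheses, because function extensionality is not available.

  liftRen-∘ : ∀ {ρ ρ′ ρ″ : ℕ → ℕ} → (∀ x → ρ (ρ′ x) ≡ ρ″ x) →
    ∀ x → liftRen ρ (liftRen ρ′ x) ≡ liftRen ρ″ x
  liftRen-∘ eq zero    = refl
  liftRen-∘ eq (suc x) = cong suc (eq x)

  rename-rename : ∀ {ρ ρ′ ρ″} → (∀ x → ρ (ρ′ x) ≡ ρ″ x) →
    ∀ M → rename ρ (rename ρ′ M) ≡ rename ρ″ M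
  rename-rename eq (var x)  = cong var (eq x)
  rename-rename eq (sort s) = refl
  rename-rename eq (M · N)  = cong₂ _·_ (rename-rename eq M) (rename-rename eq N)
  rename-rename eq (ƛ A M)  =
    cong₂ ƛ (rename-rename eq A) (rename-rename (liftRen-∘ eq) M)
  rename-rename eq (Π A B)  =
    cong₂ Π (rename-rename eq A) (rename-rename (liftRen-∘ eq) B)

  rename-wk : ∀ ρ M → rename (liftRen ρ) (wk M) ≡ wk (rename ρ M)
  rename-wk ρ M = trans (rename-rename (λ _ → refl) M)
                        (sym (rename-rename (λ _ → refl) M))

  lift-liftRen : ∀ {σ ρ τ} → (∀ x → σ (ρ x) ≡ τ x) →
    ∀ x → lift σ (liftRen ρ x) ≡ lift τ x
  lift-liftRen eq zero    = refl
  lift-liftRen eq (suc x) = cong wk (eq x)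

  subst-rename : ∀ {σ ρ τ} → (∀ x → σ (ρ x) ≡ τ x) →
    ∀ M → subst σ (rename ρ M) ≡ subst τ M
  subst-rename eq (var x)  = eq x
  subst-rename eq (sort s) = refl
  subst-rename eq (M · N)  = cong₂ _·_ (subst-rename eq M) (subst-rename eq N)
  subst-rename eq (ƛ A M)  =
    cong₂ ƛ (subst-rename eq A) (subst-rename (lift-liftRen eq) M)
  subst-rename eq (Π A B)  =
    cong₂ Π (subst-rename eq A) (subst-rename (lift-liftRen eq) B)

  liftRen-lift : ∀ {ρ σ τ} → (∀ x → rename ρ (σ x) ≡ τ x) →
    ∀ x → rename (liftRen ρ) (lift σ x) ≡ lift τ x
  liftRen-lift         eq zero    = refl
  liftRen-lift {ρ} {σ} eq (suc x) = trans (rename-wk ρ (σ x)) (cong wk (eq x))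

  rename-subst : ∀ {ρ σ τ} → (∀ x → rename ρ (σ x) ≡ τ x) →
    ∀ M → rename ρ (subst σ M) ≡ subst τ M
  rename-subst eq (var x)  = eq x
  rename-subst eq (sort s) = refl
  rename-subst eq (M · N)  = cong₂ _·_ (rename-subst eq M) (rename-subst eq N)
  rename-subst eq (ƛ A M)  =
    cong₂ ƛ (rename-subst eq A) (rename-subst (liftRen-lift eq) M)
  rename-subst eq (Π A B)  =
    cong₂ Π (rename-subst eq A) (rename-subst (liftRen-lift eq) B)

  -- Both sides collapse to the single substitution `λ x → wk (σ x)`. This is what carries
  -- composition, η and typing under a binder.
  subst-wk : ∀ σ M → subst (lift σ) (wk M) ≡ wk (subst σ M)
  subst-wk σ M = trans (subst-rename (λ _ → refl) M)
                       (sym (rename-subst (λ _ → refl) M))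

  lift-lift : ∀ {σ σ′ τ} → (∀ x → subst σ (σ′ x) ≡ τ x) →
    ∀ x → subst (lift σ) (lift σ′ x) ≡ lift τ x
  lift-lift          eq zero    = refl
  lift-lift {σ} {σ′} eq (suc x) = trans (subst-wk σ (σ′ x)) (cong wk (eq x))

  subst-subst : ∀ {σ σ′ τ} → (∀ x → subst σ (σ′ x) ≡ τ x) →
    ∀ M → subst σ (subst σ′ M) ≡ subst τ M
  subst-subst eq (var x)  = eq x
  subst-subst eq (sort s) = refl
  subst-subst eq (M · N)  = cong₂ _·_ (subst-subst eq M) (subst-subst eq N)
  subst-subst eq (ƛ A M)  =
    cong₂ ƛ (subst-subst eq A) (subst-subst (lift-lift eq) M)
  subst-subst eq (Π A B)  =
    cong₂ Π (subst-subst eq A) (subst-subst (lift-lift eq) B)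

  lift-id : ∀ {σ} → (∀ x → σ x ≡ var x) → ∀ x → lift σ x ≡ var x
  lift-id eq zero    = refl
  lift-id eq (suc x) = cong wk (eq x)

  subst-id : ∀ {σ} → (∀ x → σ x ≡ var x) → ∀ M → subst σ M ≡ M
  subst-id eq (var x)  = eq x
  subst-id eq (sort s) = refl
  subst-id eq (M · N)  = cong₂ _·_ (subst-id eq M) (subst-id eq N)
  subst-id eq (ƛ A M)  = cong₂ ƛ (subst-id eq A) (subst-id (lift-id eq) M)
  subst-id eq (Π A B)  = cong₂ Π (subst-id eq A) (subst-id (lift-id eq) B)

  subst-[] : ∀ σ M N → subst (lift σ) M [ subst σ N ] ≡ subst σ (M [ N ])
  subst-[] σ M N = trans (subst-subst pointwise M) (sym (subst-subst (λ _ → refl) M))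
    where
    pointwise : ∀ x → subst (instantiate (subst σ N)) (lift σ x)
                    ≡ subst σ (instantiate N x)
    pointwise zero    = refl
    -- Instantiation cancels the `wk` that `lift` puts around `σ x`.
    pointwise (suc x) = trans (subst-rename (λ _ → refl) (σ x))
                              (subst-id (λ _ → refl) (σ x))

  ⟶-subst : ∀ σ {M N} → M ⟶ N → subst σ M ⟶ subst σ N
  ⟶-subst σ (β {A} {M} {N}) =
    transport (ƛ (subst σ A) (subst (lift σ) M) · subst σ N ⟶_) (subst-[] σ M N) β
  ⟶-subst σ (η {A} {M}) =
    transport (λ M′ → ƛ (subst σ A) (M′ · var 0) ⟶ subst σ M) (sym (subst-wk σ M)) η
  ⟶-subst σ (·ˡ r) = ·ˡ (⟶-subst σ r)
  ⟶-subst σ (·ʳ r) = ·ʳ (⟶-subst σ r)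
  ⟶-subst σ (ƛˡ r) = ƛˡ (⟶-subst σ r)
  ⟶-subst σ (ƛʳ r) = ƛʳ (⟶-subst (lift σ) r)
  ⟶-subst σ (Πˡ r) = Πˡ (⟶-subst σ r)
  ⟶-subst σ (Πʳ r) = Πʳ (⟶-subst (lift σ) r)

  ≅-subst : ∀ σ {M N} → M ≅ N → subst σ M ≅ subst σ N
  ≅-subst σ = gmap (subst σ) (⟶-subst σ)

  -- Following premises with an unchanged context leads to the `start` or `weakening` that
  -- introduced `C`.
  head-typed : ∀ {Γ C t A} → Γ ▸ C ⊢ t ∶ A → ∃ λ s → Γ ⊢ C ∶ sort s
  head-typed (start d)         = _ , d
  head-typed (weakening d e)   = _ , e
  head-typed (product _ d e)   = head-typed d
  head-typed (application d e) = head-typed d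
  head-typed (abstraction d e) = head-typed e
  head-typed (conversion d e _) = head-typed d

  -- Axioms are given in the empty context only; weakening rebuilds the context one declaration at a
  -- time.
  axiom-wf : ∀ {Γ s₁ s₂} → WellFormed Γ → Axiom s₁ s₂ → Γ ⊢ sort s₁ ∶ sort s₂
  axiom-wf {[]}    _           a = axiom a
  axiom-wf {C ∷ Γ} (_ , _ , d) a with head-typed d
  ... | _ , e = weakening (axiom-wf (_ , _ , e) a) e

  var-wf : ∀ {Γ x A} → WellFormed Γ → Γ ∋ x ∶ A → Γ ⊢ var x ∶ A
  var-wf (_ , _ , d) here with head-typed d
  ... | _ , e = start e
  var-wf (_ , _ , d) (there i) with head-typed d
  ... | _ , e = weakening (var-wf (_ , _ , e) i) e

  Π-domain-typed : ∀ {Γ A B C} → Γ ⊢ Π A B ∶ C → ∃ λ s → Γ ⊢ A ∶ sort s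
  Π-domain-typed d = go d refl
    where
    -- The subject is a variable tied by an equation, because the index `wk A` of `weakening` does
    -- not unify with `Π A B`.
    go : ∀ {Γ M A B C} → Γ ⊢ M ∶ C → M ≡ Π A B → ∃ λ s → Γ ⊢ A ∶ sort s
    go (product _ d e) refl = _ , d
    go (weakening {A = Π _ _} d e) refl with go d refl
    ... | s , d′ = s , weakening d′ e
    go (conversion d _ _) eq = go d eq

  infix 4 _⊢_⇛_

  _⊢_⇛_ : Ctx → (ℕ → Term) → Ctx → Set
  Δ ⊢ σ ⇛ Γ = ∀ {x A} → Γ ∋ x ∶ A → Δ ⊢ σ x ∶ subst σ A

  ⇛-tail : ∀ {Γ Δ σ C} → Δ ⊢ σ ⇛ Γ ▸ C → Δ ⊢ (λ x → σ (suc x)) ⇛ Γ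
  ⇛-tail {Δ = Δ} {σ} ⊢σ {x} {A} i =
    transport (Δ ⊢ σ (suc x) ∶_) (subst-rename (λ _ → refl) A) (⊢σ (there i))

  ⇛-lift : ∀ {Γ Δ σ C s} → Δ ⊢ subst σ C ∶ sort s → Δ ⊢ σ ⇛ Γ →
    Δ ▸ subst σ C ⊢ lift σ ⇛ Γ ▸ C
  ⇛-lift {Δ = Δ} {σ} {C} ⊢C ⊢σ here =
    transport (Δ ▸ subst σ C ⊢ var 0 ∶_) (sym (subst-wk σ C)) (start ⊢C)
  ⇛-lift {Δ = Δ} {σ} {C} ⊢C ⊢σ (there {x = x} {A} i) =
    transport (Δ ▸ subst σ C ⊢ wk (σ x) ∶_) (sym (subst-wk σ A))
              (weakening (⊢σ i) ⊢C)

  -- Well-formedness of `Δ` serves the axiom case, and is re-established under each binder by typing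
  -- the substituted domain.
  ⊢-subst : ∀ {Γ Δ σ M A} → WellFormed Δ → Δ ⊢ σ ⇛ Γ →
    Γ ⊢ M ∶ A → Δ ⊢ subst σ M ∶ subst σ A
  ⊢-subst wf ⊢σ (axiom a) = axiom-wf wf a
  ⊢-subst wf ⊢σ (start d) = ⊢σ here
  ⊢-subst {Δ = Δ} wf ⊢σ (weakening {A = A} {B} d e) =
    transport₂ (Δ ⊢_∶_) (sym (subst-rename (λ _ → refl) A))
                        (sym (subst-rename (λ _ → refl) B))
               (⊢-subst wf (⇛-tail ⊢σ) d)
  ⊢-subst wf ⊢σ (product r d e) =
    product r ⊢A (⊢-subst (_ , _ , start ⊢A) (⇛-lift ⊢A ⊢σ) e)
    where ⊢A = ⊢-subst wf ⊢σ d
  ⊢-subst {Δ = Δ} {σ} wf ⊢σ (application {f = f} {a} {A} {B} d e) =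
    transport (Δ ⊢ subst σ (f · a) ∶_) (subst-[] σ B a)
              (application (⊢-subst wf ⊢σ d) (⊢-subst wf ⊢σ e))
  -- The domain has no premise of its own. Substituting into the product first and inverting the
  -- result keeps the recursion structural.
  ⊢-subst wf ⊢σ (abstraction d e) with ⊢-subst wf ⊢σ e
  ... | ⊢Π with Π-domain-typed ⊢Π
  ... | _ , ⊢A =
    abstraction (⊢-subst (_ , _ , start ⊢A) (⇛-lift ⊢A ⊢σ) d) ⊢Π
  ⊢-subst {σ = σ} wf ⊢σ (conversion d e c) =
    conversion (⊢-subst wf ⊢σ d) (⊢-subst wf ⊢σ e) (≅-subst σ c)

open λC
open PTSProperties λC.Sort λC.Axiom λC.Rule

-- `EM` is closed, so `wk EM` computes to `EM` at every depth.
em-declared : ∀ Γ → em▸ Γ ∋ length Γ ∶ EM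
em-declared []      = here
em-declared (A ∷ Γ) = there (em-declared Γ)

em▸-split : ∀ Γ {x A} → em▸ Γ ∋ x ∶ A → Γ ∋ x ∶ A ⊎ (x ≡ length Γ × A ≡ EM)
em▸-split []      here = inj₂ (refl , refl)
em▸-split (B ∷ Γ) here = inj₁ here
em▸-split (B ∷ Γ) (there i) with em▸-split Γ i
... | inj₁ j             = inj₁ (there j)
... | inj₂ (refl , refl) = inj₂ (refl , refl)

IsSubstitution⇒⇛ : ∀ {Γ Δ σ} → IsSubstitution Γ Δ σ → em▸ Δ ⊢ σ ⇛ em▸ Γ
IsSubstitution⇒⇛ {Γ} {Δ} S i with em▸-split Γ i
... | inj₁ j = IsSubstitution.typed S j
... | inj₂ (refl , refl) =
  -- Closedness again: `subst σ EM` computes to `EM`.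
  transport (em▸ Δ ⊢_∶ EM) (sym (IsSubstitution.fixes-em S))
            (var-wf (IsSubstitution.wf-target S) (em-declared Δ))

theorem8 : (P : λC.Problem) → EHOP P → λC.Provable P
theorem8 (problem Γ p ⊢p) (_ , (t , ⊢t) , σ , S , p≅) =
  subst σ t ,
  -- `⊢p` supplies the sort that conversion demands of its new type.
  conversion (⊢-subst (IsSubstitution.wf-target S) (IsSubstitution⇒⇛ S) ⊢t)
             ⊢p (symmetric _ p≅)
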